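{- Let $\varphi\mapsto\varphi^{\mathsf f}$ be any operation on team-based formulas satisfying the entailment axiom, the flatness axiom and the distributivity axiom. Let $\vec x$, $\vec y$ be tuples of variables (of the same length in (iii)) and $y$ a variable. Then: (i) for dependency atoms: $(=\!(\vec x,y))^{\mathsf f}\equiv\top$; (ii) for anonymity atoms: $(\vec x\,\Upsilon\, y)^{\mathsf f}\equiv\top$; (iii) for inclusion atoms: $(\vec x\subseteq\vec y)^{\mathsf f}\equiv\top$; (iv) for independence atoms: $(\vec x\,\bot\,\vec y)^{\mathsf f}\equiv\top$.
   Context: All models have a domain with at least two elements. A team $X$ over a model $\mathfrak M$ with domain $M$ is a set of assignments $s:\mathrm{dom}(X)\to M$ with a common set of variables $\mathrm{dom}(X)$. $\mathfrak M\models_X\varphi$ denotes satisfaction in team semantics, for teams $X$ with $\mathrm{dom}(X)\supseteq \mathrm{FV}(\varphi)$. Team-based formulas are first-order formulas in negation normal form (negation only in front of first-order atoms) extended by the following atoms: - $\mathfrak M\models_X{=}(\vec x,y)$ iff for all $s,s'\in X$, $s(\vec x)=s'(\vec x)$ implies $s(y)=s'(y)$; - $\mathfrak M\models_X\vec x\,\Upsilon\,y$ iff for every $s\in X$ there is $s'\in X$ with $s(\vec x)=s'(\vec x)$ and $s(y)\ne s'(y)$; - $\mathfrak M\models_X\vec x\subseteq\vec y$ (with $\vec x,\vec y$ of the same length) iff for every $s\in X$ there is $s'\in X$ with $s(\vec x)=s'(\vec y)$; - $\mathfrak M\models_X\vec x\,\bot\,\vec y$ iff for all $s,s'\in X$ there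 is $s''\in X$ with $s''(\vec x)=s(\vec x)$ and $s''(\vec y)=s'(\vec y)$. The formula $\top$ is satisfied by all teams in all models. $\varphi\equiv\psi$ means that $\varphi$ and $\psi$ are satisfied by the same models and teams (whose domain contains the free variables of both). A formula $\varphi$ is flat if for all $\mathfrak M$ and $X$: $\mathfrak M\models_X\varphi$ iff $\mathfrak M\models_{\{s\}}\varphi$ for all $s\in X$. The axioms for the operation $\varphi\mapsto\varphi^{\mathsf f}$ are: - (entailment axiom) for all models $\mathfrak M$ and teams $X$ over $\mathfrak M$ with $\mathrm{dom}(X)\supseteq\mathrm{FV}(\varphi)$, $\mathfrak M\models_X\varphi$ implies $\mathfrak M\models_X\varphi^{\mathsf f}$; - (flatness axiom) $\varphi^{\mathsf f}$ is a flat formula; - (distributivity axiom) $(\star(\varphi_1,\dots,\varphi_n))^{\mathsf f}=\star(\varphi_1^{\mathsf f},\dots,\varphi_n^{\mathsf f})$ for every $n$-ary logical operator $\star$, and $(Qx\varphi)^{\mathsf f}=Qx\,\varphi^{\mathsf f}$ for every quantifier $Q$.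
   Formalization: In (ii) it is assumed that y does not occur in the tuple x, and in (iii) that y_i = y_j implies x_i = x_j as variables; without these conditions the claims fail (e.g. vw ⊆ uu entails the flat formula v = w). -}

module Defs where

open import Data.Nat using (ℕ; _≟_)
open import Data.Vec using (Vec; []; _∷_)
open import Data.Vec.Relation.Unary.Any using (here; there)
open import Data.Vec.Membership.Propositional renaming (_∈_ to _∈ᵛ_) using ()
open import Data.Product using (∃; ∃₂; Σ-syntax; _×_; _,_)
open import Data.Sum using (_⊎_; inj₁; inj₂)
open import Data.Unit.Polymorphic using () renaming (⊤ to Unit)
open import Data.Empty using (⊥-elim)
open import Function using (_∘_; _⇔_)
open import Level using (Lift; 0ℓ) renaming (suc to lsuc)
open import Relation.Binary.Definitions using (_Respects_)
open import Relation.Binary.PropositionalEquality using (_≡_; _≢_; refl; trans)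
open import Relation.Nullary using (¬_; yes; no)
open import Relation.Unary using (Pred; _∈_; _⊆_; _≐_; _∪_; _∖_; ｛_｝; ∅; U)

Var : Set
Var = ℕ

record Signature : Set₁ where
  field
    Fun    : Set
    Rel    : Set
    arity  : Fun → ℕ
    arityᴿ : Rel → ℕ

------------------------------------------------------------------------
-- Syntax

module Syntax (τ : Signature) where
  open Signature τ

  data Term : Set where
    var : Var → Term
    fun : (f : Fun) → Vec Term (arity f) → Term

  data FOAtom : Set where
    _≈ᵗ_ : Term → Term → FOAtom
    rel  : (R : Rel) → Vec Term (arityᴿ R) → FOAtom

  infixr 6 _∧_
  infixr 5 _∨_

  data Formula : Set where
    ⊤         : Formula
    pos neg   : FOAtom → Formula
    dep       : ∀ {n} → Vec Var n → Var → Formula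
    anon      : ∀ {n} → Vec Var n → Var → Formula
    incl      : ∀ {n} → Vec Var n → Vec Var n → Formula
    indep     : ∀ {m n} → Vec Var m → Vec Var n → Formula
    _∧_ _∨_   : Formula → Formula → Formula
    ∃′ ∀′     : Var → Formula → Formula

  vars : ∀ {n} → Vec Var n → Pred Var 0ℓ
  vars xs v = v ∈ᵛ xs

  FVᵗ  : Term → Pred Var 0ℓ
  FVᵗˢ : ∀ {n} → Vec Term n → Pred Var 0ℓ
  FVᵗ (var x)    = ｛ x ｝
  FVᵗ (fun f ts) = FVᵗˢ ts
  FVᵗˢ []        = ∅
  FVᵗˢ (t ∷ ts)  = FVᵗ t ∪ FVᵗˢ ts

  FVᵃ : FOAtom → Pred Var 0ℓ
  FVᵃ (t ≈ᵗ u)   = FVᵗ t ∪ FVᵗ u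
  FVᵃ (rel R ts) = FVᵗˢ ts

  FV : Formula → Pred Var 0ℓ
  FV ⊤             = ∅
  FV (pos α)       = FVᵃ α
  FV (neg α)       = FVᵃ α
  FV (dep xs y)    = vars xs ∪ ｛ y ｝
  FV (anon xs y)   = vars xs ∪ ｛ y ｝
  FV (incl xs ys)  = vars xs ∪ vars ys
  FV (indep xs ys) = vars xs ∪ vars ys
  FV (φ ∧ ψ)       = FV φ ∪ FV ψ
  FV (φ ∨ ψ)       = FV φ ∪ FV ψ
  FV (∃′ x φ)      = FV φ ∖ ｛ x ｝
  FV (∀′ x φ)      = FV φ ∖ ｛ x ｝

------------------------------------------------------------------------
-- Models, assignments, teams

record Model (τ : Signature) : Set₁ where
  open Signature τ
  field
    Carrier     : Set
    twoElements : ∃₂ λ (a b : Carrier) → a ≢ b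
    funᴹ        : (f : Fun) → Vec Carrier (arity f) → Carrier
    relᴹ        : (R : Rel) → Vec Carrier (arityᴿ R) → Set

-- The proof of v ∈ D is irrelevant, so that an assignment really is a
-- function on the set D of variables.
Assignment : Set → Pred Var 0ℓ → Set
Assignment A D = (v : Var) → .(v ∈ D) → A

-- Equality of assignments is pointwise, as function extensionality is not
-- available.
infix 4 _≗ᴬ_
_≗ᴬ_ : {A : Set} {D : Pred Var 0ℓ} → Assignment A D → Assignment A D → Set
_≗ᴬ_ {D = D} s t = (v : Var) .(v∈D : v ∈ D) → s v v∈D ≡ t v v∈D

record Team (A : Set) (D : Pred Var 0ℓ) : Set₁ where
  field
    member   : Pred (Assignment A D) 0ℓ
    respects : member Respects _≗ᴬ_
open Team public

singleton : {A : Set} {D : Pred Var 0ℓ} → Assignment A D → Team A D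
singleton s .member t               = s ≗ᴬ t
singleton s .respects t≗u s≗t v v∈D = trans (s≗t v v∈D) (t≗u v v∈D)

infixl 10 _[_↦_]
_[_↦_] : {A : Set} {D : Pred Var 0ℓ} →
         Assignment A D → (x : Var) → A → Assignment A (D ∪ ｛ x ｝)
_[_↦_] {D = D} s x a v v∈ with x ≟ v
... | yes _   = a
... | no  x≢v = s v (inD v∈)
  where
  inD : v ∈ D ∪ ｛ x ｝ → v ∈ D
  inD (inj₁ v∈D) = v∈D
  inD (inj₂ x≡v) = ⊥-elim (x≢v x≡v)

-- X[F/x] = { s[x ↦ a] : s ∈ X, a ∈ F(s) }
supplement : {A : Set} {D : Pred Var 0ℓ} →
             Team A D → (Assignment A D → Pred A 0ℓ) → (x : Var) →
             Team A (D ∪ ｛ x ｝)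
supplement X F x .member t =
  ∃₂ λ s a → s ∈ member X × a ∈ F s × s [ x ↦ a ] ≗ᴬ t
supplement X F x .respects t≗u (s , a , s∈X , a∈Fs , e) =
  s , a , s∈X , a∈Fs , λ v v∈ → trans (e v v∈) (t≗u v v∈)

duplicate : {A : Set} {D : Pred Var 0ℓ} → Team A D → (x : Var) → Team A (D ∪ ｛ x ｝)
duplicate X x = supplement X (λ _ → U) x

values : {A : Set} {D : Pred Var 0ℓ} {n : ℕ} →
         Assignment A D → (xs : Vec Var n) → .((_∈ᵛ xs) ⊆ D) → Vec A n
values s []       p = []
values s (x ∷ xs) p = s x (p (here refl)) ∷ values s xs (λ i → p (there i))

∖⊆⇒⊆∪ : {P D : Pred Var 0ℓ} {x : Var} → P ∖ ｛ x ｝ ⊆ D → P ⊆ D ∪ ｛ x ｝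
∖⊆⇒⊆∪ {x = x} p {v} v∈P with x ≟ v
... | yes x≡v = inj₂ x≡v
... | no  x≢v = inj₁ (p (v∈P , x≢v))

------------------------------------------------------------------------
-- Team semantics.  Satisfaction is defined exactly for the teams whose
-- domain contains the free variables of the formula.

module Semantics {τ : Signature} where
  open Signature τ
  open Syntax τ public

  module _ (M : Model τ) where
    open Model M

    ⟦_⟧ᵗ  : {D : Pred Var 0ℓ} (t : Term) → Assignment Carrier D → .(FVᵗ t ⊆ D) → Carrier
    ⟦_⟧ᵗˢ : {D : Pred Var 0ℓ} {n : ℕ} (ts : Vec Term n) → Assignment Carrier D →
            .(FVᵗˢ ts ⊆ D) → Vec Carrier n
    ⟦ var x ⟧ᵗ    s p = s x (p refl)
    ⟦ fun f ts ⟧ᵗ s p = funᴹ f (⟦ ts ⟧ᵗˢ s p)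
    ⟦ [] ⟧ᵗˢ      s p = []
    ⟦ t ∷ ts ⟧ᵗˢ  s p = ⟦ t ⟧ᵗ s (p ∘ inj₁) ∷ ⟦ ts ⟧ᵗˢ s (p ∘ inj₂)

    Holds : {D : Pred Var 0ℓ} (α : FOAtom) → Assignment Carrier D → .(FVᵃ α ⊆ D) → Set
    Holds (t ≈ᵗ u)   s p = ⟦ t ⟧ᵗ s (p ∘ inj₁) ≡ ⟦ u ⟧ᵗ s (p ∘ inj₂)
    Holds (rel R ts) s p = relᴹ R (⟦ ts ⟧ᵗˢ s p)

    -- Disjunction and ∃ carry the lax semantics: the two parts of a split may
    -- overlap, and F assigns to each s ∈ X a nonempty set of values.
    Sat : {D : Pred Var 0ℓ} → Team Carrier D → (φ : Formula) → .(FV φ ⊆ D) → Set₁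
    Sat X ⊤ p = Unit
    Sat X (pos α) p = Lift _ (∀ s → s ∈ member X → Holds α s p)
    Sat X (neg α) p = Lift _ (∀ s → s ∈ member X → ¬ Holds α s p)
    Sat X (dep xs y) p = Lift _ (∀ s s′ → s ∈ member X → s′ ∈ member X →
      values s xs (p ∘ inj₁) ≡ values s′ xs (p ∘ inj₁) →
      s y (p (inj₂ refl)) ≡ s′ y (p (inj₂ refl)))
    Sat X (anon xs y) p = Lift _ (∀ s → s ∈ member X → ∃ λ s′ → s′ ∈ member X ×
      values s xs (p ∘ inj₁) ≡ values s′ xs (p ∘ inj₁) ×
      s y (p (inj₂ refl)) ≢ s′ y (p (inj₂ refl)))
    Sat X (incl xs ys) p = Lift _ (∀ s → s ∈ member X → ∃ λ s′ → s′ ∈ member X ×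
      values s xs (p ∘ inj₁) ≡ values s′ ys (p ∘ inj₂))
    Sat X (indep xs ys) p = Lift _ (∀ s s′ → s ∈ member X → s′ ∈ member X →
      ∃ λ s″ → s″ ∈ member X ×
      values s″ xs (p ∘ inj₁) ≡ values s xs (p ∘ inj₁) ×
      values s″ ys (p ∘ inj₂) ≡ values s′ ys (p ∘ inj₂))
    Sat X (φ ∧ ψ) p = Sat X φ (p ∘ inj₁) × Sat X ψ (p ∘ inj₂)
    Sat {D} X (φ ∨ ψ) p = ∃₂ λ (Y Z : Team Carrier D) →
      member X ≐ member Y ∪ member Z × Sat Y φ (p ∘ inj₁) × Sat Z ψ (p ∘ inj₂)
    Sat {D} X (∃′ x φ) p = Σ[ F ∈ (Assignment Carrier D → Pred Carrier 0ℓ) ]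
      Lift (lsuc 0ℓ) (∀ a → (λ s → a ∈ F s) Respects _≗ᴬ_) ×
      Lift (lsuc 0ℓ) (∀ s → s ∈ member X → ∃ λ a → a ∈ F s) ×
      Sat (supplement X F x) φ (∖⊆⇒⊆∪ p)
    Sat X (∀′ x φ) p = Sat (duplicate X x) φ (∖⊆⇒⊆∪ p)

  infix 3 _≡ᶠ_
  _≡ᶠ_ : Formula → Formula → Set₁
  φ ≡ᶠ ψ = (M : Model τ) {D : Pred Var 0ℓ} (X : Team (Model.Carrier M) D)
           (p : FV φ ⊆ D) (q : FV ψ ⊆ D) → Sat M X φ p ⇔ Sat M X ψ q

  Flat : Formula → Set₁
  Flat φ = (M : Model τ) {D : Pred Var 0ℓ} (X : Team (Model.Carrier M) D)
           (p : FV φ ⊆ D) →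
           Sat M X φ p ⇔ (∀ s → s ∈ member X → Sat M (singleton s) φ p)

  -- Negation is not among the operators over which ᶠ distributes: in negation
  -- normal form it only occurs as part of a literal.
  record IsFlattening (_ᶠ : Formula → Formula) : Set₁ where
    field
      entailment : (φ : Formula) (M : Model τ) {D : Pred Var 0ℓ}
                   (X : Team (Model.Carrier M) D) (p : FV φ ⊆ D) (q : FV (φ ᶠ) ⊆ D) →
                   Sat M X φ p → Sat M X (φ ᶠ) q
      flatness   : (φ : Formula) → Flat (φ ᶠ)
      distrib-∧  : (φ ψ : Formula) → (φ ∧ ψ) ᶠ ≡ (φ ᶠ) ∧ (ψ ᶠ)
      distrib-∨  : (φ ψ : Formula) → (φ ∨ ψ) ᶠ ≡ (φ ᶠ) ∨ (ψ ᶠ)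
      distrib-∃  : (x : Var) (φ : Formula) → (∃′ x φ) ᶠ ≡ ∃′ x (φ ᶠ)
      distrib-∀  : (x : Var) (φ : Formula) → (∀′ x φ) ᶠ ≡ ∀′ x (φ ᶠ)

-- A singleton team satisfies every dependency and every independence atom, and
-- the team of all total assignments satisfies every anonymity atom x⃗ Υ y with
-- y ∉ x⃗ and every inclusion atom whose equalities on the right also hold on the
-- left.  So every total assignment s belongs to a team satisfying the atom α;
-- by entailment and flatness {s} satisfies αᶠ.  The free variables of αᶠ need
-- not include those of α, so an assignment on a domain containing only the
-- former is first extended to a total one; locality of the (lax) team semantics
-- brings satisfaction back to the original domain.

module Submission where

open import Defs
open import Axiom.ExcludedMiddle using (ExcludedMiddle)
open import Data.Empty using (⊥-elim; ⊥-elim-irr)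
open import Data.Fin using (Fin; zero; suc)
open import Data.Fin.Properties using (any?)
open import Data.Nat using (ℕ; _≟_)
open import Data.Product using (_×_; ∃; _,_)
open import Data.Sum using (inj₁; inj₂)
open import Data.Unit.Polymorphic using (tt)
open import Data.Vec using (Vec; []; _∷_; lookup)
open import Data.Vec.Membership.Propositional renaming (_∈_ to _∈ᵛ_) using (_∉_)
open import Data.Vec.Membership.Propositional.Properties using (∈-lookup)
open import Function using (_∘_; _⇔_; mk⇔; Equivalence)
open import Level using (0ℓ; lift)
open import Relation.Binary.PropositionalEquality
  using (_≡_; _≢_; refl; sym; trans; cong; cong₂; subst)
open import Relation.Nullary using (yes; no)
open import Relation.Unary using (Pred; _∈_; _⊆_; _∪_; _∖_; ｛_｝; U)
open Semantics

private
  variable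
    A : Set
    n : ℕ
    P Q D E : Pred Var 0ℓ

-- Agreement of assignments on a set of variables.

-- The domains may differ, so that assignments can be compared across an extension; a variable of
-- `P` missing from either domain imposes no condition.
AgreeOn : Pred Var 0ℓ → Assignment A D → Assignment A E → Set
AgreeOn {D = D} {E = E} P s t =
  ∀ v → v ∈ P → .(d : v ∈ D) .(e : v ∈ E) → s v d ≡ t v e

AgreeOn-⊆ : {s : Assignment A D} {t : Assignment A E} →
            P ⊆ Q → AgreeOn Q s t → AgreeOn P s t
AgreeOn-⊆ P⊆Q s~t v v∈P = s~t v (P⊆Q v∈P)

AgreeOn-respʳ : {s : Assignment A D} {t u : Assignment A E} →
                t ≗ᴬ u → AgreeOn P s t → AgreeOn P s u
AgreeOn-respʳ t≗u s~t v v∈P d e = trans (s~t v v∈P d e) (t≗u v e)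

AgreeOn-respˡ : {s r : Assignment A D} {t : Assignment A E} →
                s ≗ᴬ r → AgreeOn P s t → AgreeOn P r t
AgreeOn-respˡ s≗r s~t v v∈P d e = trans (sym (s≗r v d)) (s~t v v∈P d e)

AgreeOn-update : {s : Assignment A D} {t : Assignment A E} (x : Var) (a : A) →
                 AgreeOn (P ∖ ｛ x ｝) s t → AgreeOn P (s [ x ↦ a ]) (t [ x ↦ a ])
AgreeOn-update x a s~t v v∈P d e with x ≟ v
... | yes _   = refl
... | no  x≢v = s~t v (v∈P , x≢v) _ _

values-cong : {s : Assignment A D} {t : Assignment A E} (xs ys : Vec Var n) →
              .(p : (_∈ᵛ xs) ⊆ D) .(q : (_∈ᵛ ys) ⊆ E) →
              (∀ i → .(d : lookup xs i ∈ D) .(e : lookup ys i ∈ E) →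
                 s (lookup xs i) d ≡ t (lookup ys i) e) →
              values s xs p ≡ values t ys q
values-cong []       []       p q eq = refl
values-cong (x ∷ xs) (y ∷ ys) p q eq =
  cong₂ _∷_ (eq zero _ _) (values-cong xs ys _ _ (λ i → eq (suc i)))

AgreeOn-values : {s : Assignment A D} {t : Assignment A E} (xs : Vec Var n) →
                 .(p : (_∈ᵛ xs) ⊆ D) .(q : (_∈ᵛ xs) ⊆ E) →
                 AgreeOn (_∈ᵛ xs) s t → values s xs p ≡ values t xs q
AgreeOn-values xs p q s~t =
  values-cong xs xs p q (λ i → s~t (lookup xs i) (∈-lookup i xs))

-- Agreement of teams, and its preservation by the team operations.

-- For `P` inside both domains this is equality of the restrictions of `X` and `Y` to `P`, phrased
-- back and forth so that no restricted team has to be formed.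
record TeamsAgreeOn (P : Pred Var 0ℓ) (X : Team A D) (Y : Team A E) : Set where
  field
    forth : ∀ s → s ∈ member X → ∃ λ t → t ∈ member Y × AgreeOn P s t
    back  : ∀ t → t ∈ member Y → ∃ λ s → s ∈ member X × AgreeOn P s t
open TeamsAgreeOn

TeamsAgreeOn-⊆ : {X : Team A D} {Y : Team A E} →
                 P ⊆ Q → TeamsAgreeOn Q X Y → TeamsAgreeOn P X Y
TeamsAgreeOn-⊆ P⊆Q X~Y .forth s s∈X with forth X~Y s s∈X
... | t , t∈Y , s~t = t , t∈Y , AgreeOn-⊆ P⊆Q s~t
TeamsAgreeOn-⊆ P⊆Q X~Y .back t t∈Y with back X~Y t t∈Y
... | s , s∈X , s~t = s , s∈X , AgreeOn-⊆ P⊆Q s~t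

-- Carries one part of a split of `X` over to `Y`. Some `t` may lie over both parts, so disjoint
-- parts can acquire overlapping images; the lax disjunction allows this.
transfer : Pred Var 0ℓ → Team A D → Team A E → Team A E
transfer P Z Y .member t = t ∈ member Y × ∃ λ s → s ∈ member Z × AgreeOn P s t
transfer P Z Y .respects t≗u (t∈Y , s , s∈Z , s~t) =
  respects Y t≗u t∈Y , s , s∈Z , AgreeOn-respʳ t≗u s~t

transfer-agrees : {X Z : Team A D} {Y : Team A E} →
                  member Z ⊆ member X → TeamsAgreeOn P X Y →
                  TeamsAgreeOn P Z (transfer P Z Y)
transfer-agrees Z⊆X X~Y .forth s s∈Z with forth X~Y s (Z⊆X s∈Z)
... | t , t∈Y , s~t = t , (t∈Y , s , s∈Z , s~t) , s~t
transfer-agrees Z⊆X X~Y .back t (_ , s∈Z) = s∈Z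

-- The union of `F s` over all `s` in `X` that agree with `t`. Taking all of them avoids choosing
-- one `s` for each `t`, and lax choice functions may be set-valued.
transferChoice : Pred Var 0ℓ → Team A D → (Assignment A D → Pred A 0ℓ) →
                 Assignment A E → Pred A 0ℓ
transferChoice P X F t a = ∃ λ s → s ∈ member X × AgreeOn P s t × a ∈ F s

supplement-agrees : {X : Team A D} {Y : Team A E} (F : Assignment A D → Pred A 0ℓ)
                    (x : Var) → TeamsAgreeOn (P ∖ ｛ x ｝) X Y →
                    TeamsAgreeOn P (supplement X F x)
                      (supplement Y (transferChoice (P ∖ ｛ x ｝) X F) x)
supplement-agrees F x X~Y .forth r (s , a , s∈X , a∈Fs , e) with forth X~Y s s∈X
... | t , t∈Y , s~t =
  t [ x ↦ a ] , (t , a , t∈Y , (s , s∈X , s~t , a∈Fs) , λ _ _ → refl) ,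
  AgreeOn-respˡ e (AgreeOn-update x a s~t)
-- The `s` must come from the choice set: another assignment of `X` agreeing with `t` need not have
-- `a` among its values.
supplement-agrees F x X~Y .back r (t , a , t∈Y , (s , s∈X , s~t , a∈Fs) , e) =
  s [ x ↦ a ] , (s , a , s∈X , a∈Fs , λ _ _ → refl) ,
  AgreeOn-respʳ e (AgreeOn-update x a s~t)

duplicate-agrees : {X : Team A D} {Y : Team A E} (x : Var) →
                   TeamsAgreeOn (P ∖ ｛ x ｝) X Y →
                   TeamsAgreeOn P (duplicate X x) (duplicate Y x)
duplicate-agrees x X~Y .forth r (s , a , s∈X , _ , e) with forth X~Y s s∈X
... | t , t∈Y , s~t =
  t [ x ↦ a ] , (t , a , t∈Y , _ , λ _ _ → refl) ,
  AgreeOn-respˡ e (AgreeOn-update x a s~t)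
duplicate-agrees x X~Y .back r (t , a , t∈Y , _ , e) with back X~Y t t∈Y
... | s , s∈X , s~t =
  s [ x ↦ a ] , (s , a , s∈X , _ , λ _ _ → refl) ,
  AgreeOn-respʳ e (AgreeOn-update x a s~t)

-- Locality of the team semantics.

module _ {τ : Signature} (M : Model τ) where
  open Model M

  ⟦⟧ᵗ-local : {s : Assignment Carrier D} {t : Assignment Carrier E} (u : Term) →
              .(p : FVᵗ u ⊆ D) .(q : FVᵗ u ⊆ E) →
              AgreeOn (FVᵗ u) s t → ⟦_⟧ᵗ M u s p ≡ ⟦_⟧ᵗ M u t q
  ⟦⟧ᵗˢ-local : {s : Assignment Carrier D} {t : Assignment Carrier E}
               (us : Vec Term n) → .(p : FVᵗˢ us ⊆ D) .(q : FVᵗˢ us ⊆ E) →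
               AgreeOn (FVᵗˢ us) s t → ⟦_⟧ᵗˢ M us s p ≡ ⟦_⟧ᵗˢ M us t q
  ⟦⟧ᵗ-local (var x)    p q s~t = s~t x refl _ _
  ⟦⟧ᵗ-local (fun f us) p q s~t = cong (funᴹ f) (⟦⟧ᵗˢ-local us p q s~t)
  ⟦⟧ᵗˢ-local []       p q s~t = refl
  ⟦⟧ᵗˢ-local (u ∷ us) p q s~t =
    cong₂ _∷_ (⟦⟧ᵗ-local u _ _ (AgreeOn-⊆ inj₁ s~t))
              (⟦⟧ᵗˢ-local us _ _ (AgreeOn-⊆ inj₂ s~t))

  Holds-local : {s : Assignment Carrier D} {t : Assignment Carrier E} (α : FOAtom) →
                .(p : FVᵃ α ⊆ D) .(q : FVᵃ α ⊆ E) →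
                AgreeOn (FVᵃ α) s t → Holds M α s p ⇔ Holds M α t q
  Holds-local (u ≈ᵗ w) p q s~t = mk⇔
    (λ h → trans (sym eqᵘ) (trans h eqʷ))
    (λ h → trans eqᵘ (trans h (sym eqʷ)))
    where
    eqᵘ = ⟦⟧ᵗ-local u _ _ (AgreeOn-⊆ inj₁ s~t)
    eqʷ = ⟦⟧ᵗ-local w _ _ (AgreeOn-⊆ inj₂ s~t)
  Holds-local (rel R us) p q s~t = mk⇔ (subst (relᴹ R) eq) (subst (relᴹ R) (sym eq))
    where eq = ⟦⟧ᵗˢ-local us p q s~t

  -- Induction on the formula. In the atoms, given assignments of `Y` are pulled back to `X`, and
  -- witnesses found in `X` are pushed forth to `Y`. Under a quantifier the bound variable receives
  -- the same value on both sides, which restores agreement on it.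
  Sat-local : {X : Team Carrier D} {Y : Team Carrier E} (φ : Formula) →
              .(p : FV φ ⊆ D) .(q : FV φ ⊆ E) →
              TeamsAgreeOn (FV φ) X Y → Sat M X φ p → Sat M Y φ q
  Sat-local ⊤ p q X~Y _ = tt
  Sat-local (pos α) p q X~Y (lift h) = lift λ t t∈Y →
    let s , s∈X , s~t = back X~Y t t∈Y
    in Equivalence.to (Holds-local α p q s~t) (h s s∈X)
  Sat-local (neg α) p q X~Y (lift h) = lift λ t t∈Y holds →
    let s , s∈X , s~t = back X~Y t t∈Y
    in h s s∈X (Equivalence.from (Holds-local α p q s~t) holds)
  Sat-local (dep xs y) p q X~Y (lift h) = lift λ t t′ t∈Y t′∈Y eq →
    let s  , s∈X  , s~t   = back X~Y t t∈Y
        s′ , s′∈X , s′~t′ = back X~Y t′ t′∈Y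
    in trans (sym (s~t y (inj₂ refl) _ _))
         (trans (h s s′ s∈X s′∈X
                  (trans (AgreeOn-values xs _ _ (AgreeOn-⊆ inj₁ s~t))
                    (trans eq (sym (AgreeOn-values xs _ _ (AgreeOn-⊆ inj₁ s′~t′))))))
                (s′~t′ y (inj₂ refl) _ _))
  Sat-local (anon xs y) p q X~Y (lift h) = lift λ t t∈Y →
    let s  , s∈X  , s~t     = back X~Y t t∈Y
        s′ , s′∈X , eq , ne = h s s∈X
        t′ , t′∈Y , s′~t′   = forth X~Y s′ s′∈X
    in t′ , t′∈Y ,
       trans (sym (AgreeOn-values xs _ _ (AgreeOn-⊆ inj₁ s~t)))
         (trans eq (AgreeOn-values xs _ _ (AgreeOn-⊆ inj₁ s′~t′))) ,
       λ e → ne (trans (s~t y (inj₂ refl) _ _)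
                  (trans e (sym (s′~t′ y (inj₂ refl) _ _))))
  Sat-local (incl xs ys) p q X~Y (lift h) = lift λ t t∈Y →
    let s  , s∈X  , s~t   = back X~Y t t∈Y
        s′ , s′∈X , eq    = h s s∈X
        t′ , t′∈Y , s′~t′ = forth X~Y s′ s′∈X
    in t′ , t′∈Y ,
       trans (sym (AgreeOn-values xs _ _ (AgreeOn-⊆ inj₁ s~t)))
         (trans eq (AgreeOn-values ys _ _ (AgreeOn-⊆ inj₂ s′~t′)))
  Sat-local (indep xs ys) p q X~Y (lift h) = lift λ t t′ t∈Y t′∈Y →
    let s  , s∈X  , s~t       = back X~Y t t∈Y
        s′ , s′∈X , s′~t′     = back X~Y t′ t′∈Y
        s″ , s″∈X , eqˣ , eqʸ = h s s′ s∈X s′∈X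
        t″ , t″∈Y , s″~t″     = forth X~Y s″ s″∈X
    in t″ , t″∈Y ,
       trans (sym (AgreeOn-values xs _ _ (AgreeOn-⊆ inj₁ s″~t″)))
         (trans eqˣ (AgreeOn-values xs _ _ (AgreeOn-⊆ inj₁ s~t))) ,
       trans (sym (AgreeOn-values ys _ _ (AgreeOn-⊆ inj₂ s″~t″)))
         (trans eqʸ (AgreeOn-values ys _ _ (AgreeOn-⊆ inj₂ s′~t′)))
  Sat-local (φ ∧ ψ) p q X~Y (hφ , hψ) =
    Sat-local φ _ _ (TeamsAgreeOn-⊆ inj₁ X~Y) hφ ,
    Sat-local ψ _ _ (TeamsAgreeOn-⊆ inj₂ X~Y) hψ
  Sat-local {Y = Y} (φ ∨ ψ) p q X~Y (X₁ , X₂ , (X⊆ , ⊆X) , hφ , hψ) =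
    transfer (FV (φ ∨ ψ)) X₁ Y , transfer (FV (φ ∨ ψ)) X₂ Y ,
    (split , λ { (inj₁ (t∈Y , _)) → t∈Y ; (inj₂ (t∈Y , _)) → t∈Y }) ,
    Sat-local φ _ _ (TeamsAgreeOn-⊆ inj₁ (transfer-agrees (⊆X ∘ inj₁) X~Y)) hφ ,
    Sat-local ψ _ _ (TeamsAgreeOn-⊆ inj₂ (transfer-agrees (⊆X ∘ inj₂) X~Y)) hψ
    where
    split : member Y ⊆ member (transfer (FV (φ ∨ ψ)) X₁ Y)
                       ∪ member (transfer (FV (φ ∨ ψ)) X₂ Y)
    split {t} t∈Y with back X~Y t t∈Y
    ... | s , s∈X , s~t with X⊆ s∈X
    ... | inj₁ s∈X₁ = inj₁ (t∈Y , s , s∈X₁ , s~t)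
    ... | inj₂ s∈X₂ = inj₂ (t∈Y , s , s∈X₂ , s~t)
  Sat-local {X = X} {Y = Y} (∃′ x φ) p q X~Y (F , _ , lift nonempty , h) =
    transferChoice (FV φ ∖ ｛ x ｝) X F ,
    lift (λ { a t≗u (s , s∈X , s~t , a∈Fs) →
              s , s∈X , AgreeOn-respʳ t≗u s~t , a∈Fs }) ,
    lift (λ t t∈Y → let s , s∈X , s~t = back X~Y t t∈Y
                        a , a∈Fs      = nonempty s s∈X
                    in a , s , s∈X , s~t , a∈Fs) ,
    Sat-local φ _ _ (supplement-agrees F x X~Y) h
  Sat-local (∀′ x φ) p q X~Y h = Sat-local φ _ _ (duplicate-agrees x X~Y) h

-- Teams satisfying the atoms.

full : Team A D
full .member   = U
full .respects = _

module _ {τ : Signature} (M : Model τ) where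
  open Model M

  Sat-singleton-dep : (s : Assignment Carrier D) (xs : Vec Var n) (y : Var) →
                      .(p : FV {τ} (dep xs y) ⊆ D) → Sat M (singleton s) (dep xs y) p
  Sat-singleton-dep s xs y p =
    lift λ t u s≗t s≗u _ → trans (sym (s≗t y _)) (s≗u y _)

  Sat-singleton-indep : ∀ {m} (s : Assignment Carrier D) (xs : Vec Var m)
                        (ys : Vec Var n) → .(p : FV {τ} (indep xs ys) ⊆ D) →
                        Sat M (singleton s) (indep xs ys) p
  Sat-singleton-indep s xs ys p = lift λ t u s≗t s≗u →
    t , s≗t , refl ,
    values-cong ys ys _ _ (λ i d _ → trans (sym (s≗t (lookup ys i) d)) (s≗u (lookup ys i) d))

  module _ (em : ExcludedMiddle 0ℓ) where

    different : (c : Carrier) → ∃ λ d → c ≢ d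
    different c with twoElements
    ... | a , b , a≢b with em {c ≡ a}
    ... | yes refl = b , a≢b
    ... | no  c≢a  = a , c≢a

    -- Changing `s` at `y` alone leaves the values of `xs` intact because `y ∉ xs`. If `y` occurred
    -- in `xs`, only the empty team would satisfy the atom.
    Sat-full-anon : (xs : Vec Var n) (y : Var) → y ∉ xs →
                    Sat M {U} full (anon xs y) _
    Sat-full-anon xs y y∉xs = lift λ s _ →
      let d , sy≢d = different (s y _)
      in update s d , _ ,
         values-cong xs xs _ _ (λ i _ _ → sym (update-≢ s d (y≢xs i))) ,
         λ eq → sy≢d (trans eq (update-≡ s d))
      where
      -- The update `s [ y ↦ d ]` has domain `U ∪ ｛ y ｝`; this brings it back to `U`.
      update : Assignment Carrier U → Carrier → Assignment Carrier U
      update s d v _ = (s [ y ↦ d ]) v (inj₁ _)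

      update-≡ : ∀ s d → update s d y _ ≡ d
      update-≡ s d with y ≟ y
      ... | yes _   = refl
      ... | no  y≢y = ⊥-elim (y≢y refl)

      update-≢ : ∀ s d {v} → y ≢ v → update s d v _ ≡ s v _
      update-≢ s d {v} y≢v with y ≟ v
      ... | yes y≡v = ⊥-elim (y≢v y≡v)
      ... | no  _   = refl

      y≢xs : ∀ i → y ≢ lookup xs i
      y≢xs i refl = y∉xs (∈-lookup i xs)

  -- The witness sends each `lookup ys i` to the value of `s` at `lookup xs i`. The hypothesis makes
  -- these demands consistent when a variable is repeated in `ys`.
  Sat-full-incl : (xs ys : Vec Var n) →
                  (∀ i j → lookup ys i ≡ lookup ys j → lookup xs i ≡ lookup xs j) →
                  Sat M {U} full (incl xs ys) _
  Sat-full-incl xs ys ys⇒xs = lift λ s _ →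
    pullback s , _ , values-cong xs ys _ _ (λ i _ _ → pullback-lookup s i)
    where
    pullback : Assignment Carrier U → Assignment Carrier U
    pullback s v _ with any? (λ i → lookup ys i ≟ v)
    ... | yes (i , _) = s (lookup xs i) _
    ... | no  _       = s v _

    pullback-lookup : ∀ s i → s (lookup xs i) _ ≡ pullback s (lookup ys i) _
    pullback-lookup s i with any? (λ j → lookup ys j ≟ lookup ys i)
    -- The search may return an index `j` other than `i`; the entries of `xs` at both indices are
    -- nevertheless the same variable.
    ... | yes (j , eq) = cong (λ v → s v _) (ys⇒xs i j (sym eq))
    ... | no  ∄j       = ⊥-elim (∄j (i , refl))

-- Extension to total assignments and the flattening of atoms.

totalise : ExcludedMiddle 0ℓ → A → Assignment A D → Assignment A U
totalise {D = D} em a s v _ with em {v ∈ D}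
... | yes v∈D = s v v∈D
... | no  _   = a

totalise-agrees : (em : ExcludedMiddle 0ℓ) (a : A) (s : Assignment A D) →
                  AgreeOn P (totalise em a s) s
totalise-agrees {D = D} em a s v _ _ v∈D with em {v ∈ D}
... | yes _   = refl
... | no  v∉D = ⊥-elim-irr (v∉D v∈D)

singletons-agree : {s : Assignment A D} {t : Assignment A E} →
                   AgreeOn P s t → TeamsAgreeOn P (singleton s) (singleton t)
singletons-agree {t = t} s~t .forth r s≗r =
  t , (λ _ _ → refl) , AgreeOn-respˡ s≗r s~t
singletons-agree {s = s} s~t .back r t≗r =
  s , (λ _ _ → refl) , AgreeOn-respʳ t≗r s~t

module _ (em : ExcludedMiddle 0ℓ) {τ : Signature} {_ᶠ : Formula {τ} → Formula {τ}}
         (isFlattening : IsFlattening _ᶠ) where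
  open IsFlattening isFlattening

  -- Covering is required over the domain `U` only, where the free variables of both `φ` and `φ ᶠ`
  -- lie automatically, so entailment applies whatever the relation between them.
  flattening-⊤ : (φ : Formula) →
    ((M : Model τ) (s : Assignment (Model.Carrier M) U) →
     ∃ λ (X : Team (Model.Carrier M) U) → s ∈ member X × Sat M X φ _) →
    (φ ᶠ) ≡ᶠ ⊤
  flattening-⊤ φ covered M X p _ = mk⇔ _ λ _ →
    Equivalence.from (flatness φ M X p) λ s _ →
      -- The default value for variables outside `D`.
      let a , _         = Model.twoElements M
          s̄             = totalise em a s
          Y , s̄∈Y , Y⊨φ = covered M s̄
          -- Entailment passes from `φ` to `φ ᶠ` on `Y`; flatness then descends from `Y` to its
          -- member `s̄`.
          s̄⊨φᶠ          = Equivalence.to (flatness φ M Y _) (entailment φ M Y _ _ Y⊨φ) s̄ s̄∈Y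
      in Sat-local M (φ ᶠ) _ p (singletons-agree (totalise-agrees em a s)) s̄⊨φᶠ

proposition3p1 : ExcludedMiddle 0ℓ →
    (τ : Signature) (_ᶠ : Formula {τ} → Formula {τ}) → IsFlattening _ᶠ →
    (∀ {n} (xs : Vec Var n) (y : Var) → (dep xs y ᶠ) ≡ᶠ ⊤) ×
    (∀ {n} (xs : Vec Var n) (y : Var) → y ∉ xs → (anon xs y ᶠ) ≡ᶠ ⊤) ×
    (∀ {n} (xs ys : Vec Var n) →
      (∀ (i j : Fin n) → lookup ys i ≡ lookup ys j → lookup xs i ≡ lookup xs j) →
      (incl xs ys ᶠ) ≡ᶠ ⊤) ×
    (∀ {m n} (xs : Vec Var m) (ys : Vec Var n) → (indep xs ys ᶠ) ≡ᶠ ⊤)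
proposition3p1 em τ _ᶠ isFlattening =
  (λ xs y → flattening-⊤ em isFlattening (dep xs y) λ M s →
     singleton s , (λ _ _ → refl) , Sat-singleton-dep M s xs y _) ,
  (λ xs y y∉xs → flattening-⊤ em isFlattening (anon xs y) λ M s →
     full , _ , Sat-full-anon M em xs y y∉xs) ,
  (λ xs ys ys⇒xs → flattening-⊤ em isFlattening (incl xs ys) λ M s →
     full , _ , Sat-full-incl M xs ys ys⇒xs) ,
  (λ xs ys → flattening-⊤ em isFlattening (indep xs ys) λ M s →
     singleton s , (λ _ _ → refl) , Sat-singleton-indep M s xs ys _)
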